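{- If $T\subseteq\mathbb{Z}^n$ is an integer tiling with $\Upsilon_n$, then $n\not\equiv 4\pmod 6$.
   Context: $\Upsilon_n=\{U\in\mathbb{Z}^n:\sum_i|x_i-u_i|\le1\text{ for some }X\in\{ -1,0\}^n\}$. A set $T\subseteq\mathbb{Z}^n$ is an integer tiling with $\Upsilon_n$ if the translates $X+\Upsilon_n$, $X\in T$, partition $\mathbb{Z}^n$. -}

module Defs where

open import Data.Nat using (ℕ; _≤_)
open import Data.Integer using (ℤ; _-_; ∣_∣; -[1+_]; +_)
open import Data.Vec using (Vec; zipWith; sum)
open import Data.Vec.Relation.Unary.All using (All)
open import Data.Product using (Σ; _×_; ∃)
open import Data.Sum using (_⊎_)
open import Relation.Binary.PropositionalEquality using (_≡_)

Point : ℕ → Set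
Point n = Vec ℤ n

dist₁ : ∀ {n} → Point n → Point n → ℕ
dist₁ X U = sum (zipWith (λ x u → ∣ x - u ∣) X U)

InMinusOneZero : ∀ {n} → Point n → Set
InMinusOneZero X = All (λ x → x ≡ -[1+ 0 ] ⊎ x ≡ + 0) X

Upsilon : (n : ℕ) → Point n → Set
Upsilon n U = Σ (Point n) (λ X → InMinusOneZero X × dist₁ X U ≤ 1)

InTranslate : (n : ℕ) → Point n → Point n → Set
InTranslate n X Z = Upsilon n (zipWith _-_ Z X)

IsIntegerTiling : (n : ℕ) → (Point n → Set) → Set
IsIntegerTiling n T =
  ((Z : Point n) → Σ (Point n) (λ X → T X × InTranslate n X Z)) ×
  ((Z X Y : Point n) → T X → T Y → InTranslate n X Z → InTranslate n Y Z → X ≡ Y)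

-- Let D be the union of the cubes X + {-1,0}ⁿ, X ∈ T. A point of D has n neighbours in D and any other
-- point has exactly one, so the sum N of the 2n unit shifts satisfies N 1_D = 1 + (n-1) 1_D. As n is
-- even and n ≡ 1 (mod 3), the congruences N² ≡ Σ (shift)² (mod 2) and N³ ≡ Σ (shift)³ (mod 3) show that
-- the number of points of D among w ± 2eᵢ is odd for w ∉ D, and that some w ± 3eᵢ is always in D.
-- Let z ∈ D, and orient each axis so that z + eᵢ ∉ D. Since z + 2eⱼ has a unique neighbour in D, for
-- each j there is exactly one i with z + 2eⱼ + eᵢ ∈ D. This relation between i and j is inherited by the
-- adjacent corners z - eₖ, k ≠ i, j, of the cube, and with that the two counts at z + eᵢ and at
-- z - eₖ + eᵢ show that each i arises from at least two j, which is impossible.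

module Submission where

open import Defs
open import Data.Fin as Fin using (Fin; zero; suc)
import Data.Fin.Properties as Fin
open import Data.Integer using (ℤ; 0ℤ; 1ℤ; -1ℤ; ∣_∣; _◃_)
  renaming (_+_ to infixl 6 _+ℤ_; _-_ to infixl 6 _-ℤ_)
import Data.Integer as ℤ
import Data.Integer.Properties as ℤ
open import Data.List using (List; []; _∷_; map; length; cartesianProduct; allFin)
open import Data.List.Properties using (map-cong; length-tabulate)
open import Data.List.Membership.Propositional using (_∈_; lose)
open import Data.List.Membership.Propositional.Properties using (∈-cartesianProduct⁺; ∈-allFin)
open import Data.List.Relation.Unary.All as All using ([]; _∷_)
open import Data.List.Relation.Unary.AllPairs using ([]; _∷_)
open import Data.List.Relation.Unary.Any as Any using (here; there)
open import Data.List.Relation.Unary.Unique.Propositional using (Unique)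
open import Data.List.Relation.Unary.Unique.Propositional.Properties using (allFin⁺; cartesianProduct⁺)
open import Data.Nat using (ℕ; zero; suc; _+_; _*_; _%_; _/_; _≤_; z≤n; s≤s)
open import Data.Nat.DivMod using (m≡m%n+[m/n]*n; [m+kn]%n≡m%n)
open import Data.Nat.ListAction using (sum)
open import Data.Nat.Properties
  using (+-identityʳ; *-zeroʳ; *-identityʳ; +-comm; n<1+n; <-irrefl; ≤-trans; ≤-reflexive;
         n≤0⇒n≡0; m+n≡0⇒m≡0; m+n≡0⇒n≡0)
open import Data.Nat.Tactic.RingSolver using (solve-∀)
open import Data.Product using (_×_; _,_; proj₁; proj₂; ∃-syntax)
open import Data.Product.Properties using (≡-dec)
open import Data.Sign using (Sign; opposite)
import Data.Sign.Properties as Sign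
open import Data.Sum as Sum using (_⊎_; inj₁; inj₂)
open import Data.Vec using ([]; _∷_; zipWith; replicate; _[_]%=_)
open import Data.Vec.Relation.Unary.All using ([]; _∷_; all?)
open import Function using (_∘_)
open import Relation.Binary.Definitions using (DecidableEquality)
open import Relation.Binary.PropositionalEquality
  using (_≡_; _≢_; refl; sym; trans; cong; cong₂; subst; module ≡-Reasoning)
open import Relation.Nullary using (¬_; Dec; yes; no; contradiction)
open import Relation.Nullary.Decidable using (¬?; _×-dec_; _⊎-dec_)

-- Sums supported on at most two elements of a list.

module _ {A : Set} (h : A → ℕ) where

  sum-zero : ∀ {as} → (∀ {a} → a ∈ as → h a ≡ 0) → sum (map h as) ≡ 0
  sum-zero {[]}     _  = refl
  sum-zero {a ∷ as} h₀ = cong₂ _+_ (h₀ (here refl)) (sum-zero (h₀ ∘ there))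

  sum-single : ∀ {as a} → Unique as → a ∈ as → (∀ {b} → b ∈ as → b ≢ a → h b ≡ 0) →
               sum (map h as) ≡ h a
  sum-single {a ∷ as} (a∉as ∷ _) (here refl) h₀ =
    trans (cong (h a +_) (sum-zero λ b∈as → h₀ (there b∈as) (All.lookup a∉as b∈as ∘ sym)))
          (+-identityʳ _)
  sum-single (b∉as ∷ !as) (there a∈as) h₀ =
    cong₂ _+_ (h₀ (here refl) (All.lookup b∉as a∈as)) (sum-single !as a∈as (h₀ ∘ there))

  sum-pair : ∀ {as a b} → Unique as → a ∈ as → b ∈ as → a ≢ b →
             (∀ {c} → c ∈ as → c ≢ a → c ≢ b → h c ≡ 0) → sum (map h as) ≡ h a + h b
  sum-pair _ (here refl) (here refl) a≢b _ = contradiction refl a≢b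
  sum-pair {a ∷ as} (a∉as ∷ !as) (here refl) (there b∈as) a≢b h₀ =
    cong (h a +_) (sum-single !as b∈as λ c∈as → h₀ (there c∈as) (All.lookup a∉as c∈as ∘ sym))
  sum-pair {b ∷ as} {a} (b∉as ∷ !as) (there a∈as) (here refl) a≢b h₀ =
    trans (cong (h b +_) (sum-single !as a∈as λ c∈as c≢a →
             h₀ (there c∈as) c≢a (All.lookup b∉as c∈as ∘ sym)))
          (+-comm (h b) (h a))
  sum-pair (c∉as ∷ !as) (there a∈as) (there b∈as) a≢b h₀ =
    cong₂ _+_ (h₀ (here refl) (All.lookup c∉as a∈as) (All.lookup c∉as b∈as))
              (sum-pair !as a∈as b∈as a≢b (h₀ ∘ there))

-- Sums of commuting shifts and their powers modulo 2 and 3.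

module Shifts {P S : Set} (_·_ : P → S → P)
              (·-comm : ∀ z a b → ((z · a) · b) ≡ ((z · b) · a)) where

  neighbourSum : List S → (P → ℕ) → P → ℕ
  neighbourSum as h w = sum (map (λ a → h (w · a)) as)

  neighbourSum-cong : ∀ as {h k} → (∀ u → h u ≡ k u) → ∀ w → neighbourSum as h w ≡ neighbourSum as k w
  neighbourSum-cong as h≗k w = cong sum (map-cong (λ a → h≗k (w · a)) as)

  neighbourSum-+ : ∀ as h k w →
    neighbourSum as (λ u → h u + k u) w ≡ neighbourSum as h w + neighbourSum as k w
  neighbourSum-+ []       h k w = refl
  neighbourSum-+ (a ∷ as) h k w =
    trans (cong (h (w · a) + k (w · a) +_) (neighbourSum-+ as h k w))
          (eq (h (w · a)) (k (w · a)) (neighbourSum as h w) (neighbourSum as k w))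
    where
    eq : ∀ x y s t → x + y + (s + t) ≡ x + s + (y + t)
    eq = solve-∀

  -- An identity `N h = c + m * h` can be iterated with this: a constant is multiplied by the number
  -- of shifts.
  neighbourSum-affine : ∀ as c m h w →
    neighbourSum as (λ u → c + m * h u) w ≡ length as * c + m * neighbourSum as h w
  neighbourSum-affine []       c m h w = sym (*-zeroʳ m)
  neighbourSum-affine (a ∷ as) c m h w =
    trans (cong (c + m * h (w · a) +_) (neighbourSum-affine as c m h w))
          (eq c m (h (w · a)) (length as) (neighbourSum as h w))
    where
    eq : ∀ c m x l s → c + m * x + (l * c + m * s) ≡ c + l * c + m * (x + s)
    eq = solve-∀

  neighbourSum-shift : ∀ as h w b →
    neighbourSum as (λ u → h (u · b)) w ≡ neighbourSum as h (w · b)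
  neighbourSum-shift as h w b = cong sum (map-cong (λ a → cong h (·-comm w a b)) as)

  -- With `S` the shift by `a` and `N` the sum over `as`, this is `(S + N)² = S² + 2SN + N²`; the
  -- shifts commute, so `SN = NS`.
  neighbourSum²-∷ : ∀ a as h w → let N = neighbourSum as; N′ = neighbourSum (a ∷ as) in
    N′ (N′ h) w ≡ h ((w · a) · a) + 2 * N h (w · a) + N (N h) w
  neighbourSum²-∷ a as h w = begin
    x + y + N (λ u → h (u · a) + N h u) w
      ≡⟨ cong (x + y +_) (neighbourSum-+ as (λ u → h (u · a)) (N h) w) ⟩
    x + y + (N (λ u → h (u · a)) w + N (N h) w)
      ≡⟨ cong (λ s → x + y + (s + N (N h) w)) (neighbourSum-shift as h w a) ⟩
    x + y + (y + N (N h) w)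
      ≡⟨ eq x y (N (N h) w) ⟩
    x + 2 * y + N (N h) w ∎
    where
    open ≡-Reasoning
    N = neighbourSum as
    x = h ((w · a) · a)
    y = N h (w · a)
    eq : ∀ x y t → x + y + (y + t) ≡ x + 2 * y + t
    eq = solve-∀

  -- In the same notation, `(S + N)³ = S³ + 3(S²N + SN²) + N³`.
  neighbourSum³-∷ : ∀ a as h w → let N = neighbourSum as; N′ = neighbourSum (a ∷ as) in
    N′ (N′ (N′ h)) w ≡
    h (((w · a) · a) · a) + 3 * (N h ((w · a) · a) + N (N h) (w · a)) + N (N (N h)) w
  neighbourSum³-∷ a as h w = begin
    N′ (N′ h) (w · a) + N (N′ (N′ h)) w
      ≡⟨ cong₂ _+_ (neighbourSum²-∷ a as h (w · a)) (neighbourSum-cong as (neighbourSum²-∷ a as h) w) ⟩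
    x + 2 * y + z + N (λ u → f u + 2 * g u + N (N h) u) w
      ≡⟨ cong (x + 2 * y + z +_) (neighbourSum-+ as (λ u → f u + 2 * g u) (N (N h)) w) ⟩
    x + 2 * y + z + (N (λ u → f u + 2 * g u) w + t)
      ≡⟨ cong (λ s → x + 2 * y + z + (s + t)) (neighbourSum-+ as f (λ u → 2 * g u) w) ⟩
    x + 2 * y + z + (N f w + N (λ u → 2 * g u) w + t)
      ≡⟨ cong₂ (λ p q → x + 2 * y + z + (p + q + t))
           (trans (neighbourSum-shift as (λ u → h (u · a)) w a) (neighbourSum-shift as h (w · a) a))
           (trans (neighbourSum-affine as 0 2 g w)
                  (cong (λ s → length as * 0 + 2 * s) (neighbourSum-shift as (N h) w a))) ⟩
    x + 2 * y + z + (y + (length as * 0 + 2 * z) + t)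
      ≡⟨ eq x y z t (length as) ⟩
    x + 3 * (y + z) + t ∎
    where
    open ≡-Reasoning
    N = neighbourSum as
    N′ = neighbourSum (a ∷ as)
    f g : P → ℕ
    f u = h ((u · a) · a)
    g u = N h (u · a)
    x = h (((w · a) · a) · a)
    y = N h ((w · a) · a)
    z = N (N h) (w · a)
    t = N (N (N h)) w
    eq : ∀ x y z t l → x + 2 * y + z + (y + (l * 0 + 2 * z) + t) ≡ x + 3 * (y + z) + t
    eq = solve-∀

  -- The mixed terms of the expanded square are even. The multiple of 2 is explicit, so that the
  -- congruence is an equation between natural numbers.
  frobenius₂ : ∀ as h w → ∃[ r ]
    neighbourSum as (neighbourSum as h) w ≡ sum (map (λ a → h ((w · a) · a)) as) + r * 2
  frobenius₂ []       h w = 0 , refl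
  frobenius₂ (a ∷ as) h w with frobenius₂ as h w
  ... | r , N²h≡ = y + r ,
    trans (neighbourSum²-∷ a as h w) (trans (cong (x + 2 * y +_) N²h≡) (eq x y s r))
    where
    x = h ((w · a) · a)
    y = neighbourSum as h (w · a)
    s = sum (map (λ a → h ((w · a) · a)) as)
    eq : ∀ x y s r → x + 2 * y + (s + r * 2) ≡ x + s + (y + r) * 2
    eq = solve-∀

  frobenius₃ : ∀ as h w → ∃[ r ]
    neighbourSum as (neighbourSum as (neighbourSum as h)) w ≡
    sum (map (λ a → h (((w · a) · a) · a)) as) + r * 3
  frobenius₃ []       h w = 0 , refl
  frobenius₃ (a ∷ as) h w with frobenius₃ as h w
  ... | r , N³h≡ = y + r ,
    trans (neighbourSum³-∷ a as h w) (trans (cong (x + 3 * y +_) N³h≡) (eq x y s r))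
    where
    x = h (((w · a) · a) · a)
    y = neighbourSum as h ((w · a) · a) + neighbourSum as (neighbourSum as h) (w · a)
    s = sum (map (λ a → h (((w · a) · a) · a)) as)
    eq : ∀ x y s r → x + 3 * y + (s + r * 3) ≡ x + s + (y + r) * 3
    eq = solve-∀

-- The 2n directions along the coordinate axes.

Direction : ℕ → Set
Direction n = Fin n × Sign

opp : ∀ {n} → Direction n → Direction n
opp (i , s) = i , opposite s

opp-involutive : ∀ {n} (a : Direction n) → opp (opp a) ≡ a
opp-involutive (i , s) = cong (i ,_) (Sign.opposite-involutive s)

same-axis : ∀ {n} (a b : Direction n) → proj₁ a ≡ proj₁ b → b ≡ a ⊎ b ≡ opp a
same-axis (i , Sign.+) (.i , Sign.+) refl = inj₁ refl
same-axis (i , Sign.+) (.i , Sign.-) refl = inj₂ refl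
same-axis (i , Sign.-) (.i , Sign.+) refl = inj₂ refl
same-axis (i , Sign.-) (.i , Sign.-) refl = inj₁ refl

_≟_ : ∀ {n} → DecidableEquality (Direction n)
_≟_ = ≡-dec Fin._≟_ Sign._≟_

signs : List Sign
signs = Sign.+ ∷ Sign.- ∷ []

directions : ∀ n → List (Direction n)
directions n = cartesianProduct (allFin n) signs

∈-directions : ∀ {n} (a : Direction n) → a ∈ directions n
∈-directions (i , Sign.+) = ∈-cartesianProduct⁺ (∈-allFin i) (here refl)
∈-directions (i , Sign.-) = ∈-cartesianProduct⁺ (∈-allFin i) (there (here refl))

directions-unique : ∀ n → Unique (directions n)
directions-unique n = cartesianProduct⁺ (allFin⁺ n) (((λ ()) ∷ []) ∷ [] ∷ [])

length-× : ∀ {A : Set} (as : List A) → length (cartesianProduct as signs) ≡ length as * 2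
length-× []       = refl
length-× (_ ∷ as) = cong (2 +_) (length-× as)

length-directions : ∀ n → length (directions n) ≡ n * 2
length-directions n = trans (length-× (allFin n)) (cong (_* 2) (length-tabulate {n = n} (λ i → i)))

-- The product list keeps the two signs of an element adjacent, so the sum splits into pairs, each
-- worth 1.
sum-signs : ∀ {A : Set} (h : A × Sign → ℕ) → (∀ a → h (a , Sign.+) + h (a , Sign.-) ≡ 1) →
            ∀ as → sum (map h (cartesianProduct as signs)) ≡ length as
sum-signs h h≡1 []       = refl
sum-signs h h≡1 (a ∷ as) =
  trans (eq (h (a , Sign.+)) (h (a , Sign.-)) (sum (map h (cartesianProduct as signs))))
        (cong₂ _+_ (h≡1 a) (sum-signs h h≡1 as))
  where
  eq : ∀ x y s → x + (y + s) ≡ x + y + s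
  eq = solve-∀

-- The combinatorial structure extracted from a tiling.

-- What the argument uses of the union D of the cubes X + {-1,0}ⁿ, X ∈ T.
record CubeDomination (n : ℕ) : Set₁ where
  infixl 6 _·_
  field
    Pt                : Set
    _·_               : Pt → Direction n → Pt
    ·-comm            : ∀ z a b → z · a · b ≡ z · b · a
    ·-opp             : ∀ z a → z · a · opp a ≡ z
    D                 : Pt → Set
    D?                : ∀ z → Dec (D z)
    dominated         : ∀ {w} → ¬ D w → ∃[ a ] D (w · a)
    dominator-unique  : ∀ {w a b} → ¬ D w → D (w · a) → D (w · b) → a ≡ b
    cube-neighbour    : ∀ {w} → D w → ∀ a → D (w · a) ⊎ D (w · opp a)
    cube-neighbour-unique : ∀ {w a} → D w → D (w · a) → ¬ D (w · opp a)

-- Outward directions at a point of D and double steps along them.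

module Corners {n : ℕ} (𝒟 : CubeDomination n) where
  open CubeDomination 𝒟

  Out : Pt → Direction n → Set
  Out z a = ¬ D (z · a)

  ·-rotate : ∀ z a b c → z · a · b · c ≡ z · c · a · b
  ·-rotate z a b c = trans (·-comm (z · a) b c) (cong (_· b) (·-comm z a c))

  ·-cancel : ∀ z a b → z · a · b · opp a ≡ z · b
  ·-cancel z a b = trans (·-comm (z · a) b (opp a)) (cong (_· b) (·-opp z a))

  ≡opp-sym : ∀ {a b : Direction n} → a ≡ opp b → b ≡ opp a
  ≡opp-sym {b = b} refl = sym (opp-involutive b)

  inner : ∀ {z a} → D z → Out z a → D (z · opp a)
  inner {a = a} z∈D a-out with cube-neighbour z∈D a
  ... | inj₁ za∈D = contradiction za∈D a-out
  ... | inj₂ zā∈D = zā∈D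

  out-on-axis : ∀ {z} → D z → ∀ i → ∃[ a ] (proj₁ a ≡ i × Out z a)
  out-on-axis {z} z∈D i with D? (z · (i , Sign.+))
  ... | yes p = (i , Sign.-) , refl , cube-neighbour-unique z∈D p
  ... | no ¬p = (i , Sign.+) , refl , ¬p

  out-axis-injective : ∀ {z a b} → D z → Out z a → Out z b → proj₁ a ≡ proj₁ b → a ≡ b
  out-axis-injective {a = a} {b} z∈D a-out b-out eq with same-axis a b eq
  ... | inj₁ refl = refl
  ... | inj₂ refl = contradiction (inner z∈D a-out) b-out

  -- The point `z · a` is outside `D` and is dominated by `z` itself, so no other step from it
  -- enters `D`.
  return : ∀ {z a b} → D z → Out z a → D (z · a · b) → b ≡ opp a
  return {z} {a} z∈D a-out zab∈D =
    dominator-unique a-out zab∈D (subst D (sym (·-opp z a)) z∈D)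

  out-out : ∀ {z a b} → D z → Out z a → Out z b → ¬ D (z · a · b)
  out-out z∈D a-out b-out zab∈D with return z∈D a-out zab∈D
  ... | refl = b-out (inner z∈D a-out)

  -- Outward directions on the other axes persist at the adjacent corner `z · e`: if `z · e · a`
  -- were in `D`, then `e` would lead from `z · a` into `D`, and `return` would make it `opp a`.
  flip-out : ∀ {z a e} → D z → D (z · e) → Out z a → a ≢ opp e → Out (z · e) a
  flip-out {z} {a} {e} z∈D ze∈D a-out a≢ē zea∈D =
    a≢ē (≡opp-sym (return z∈D a-out (subst D (·-comm z e a) zea∈D)))

  flip-out-self : ∀ {z e} → D z → D (z · e) → Out (z · e) e
  flip-out-self {z} {e} z∈D ze∈D zee∈D =
    cube-neighbour-unique ze∈D zee∈D (subst D (sym (·-opp z e)) z∈D)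

  -- An inward `c` either cancels `a` or `b`, leaving a single outward step, or leads to a corner
  -- where `a` and `b` are still outward, against `out-out`.
  dominator-out : ∀ {z a b c} → D z → Out z a → Out z b → D (z · a · b · c) → Out z c
  dominator-out {z} {a} {b} {c} z∈D a-out b-out zabc∈D zc∈D with c ≟ opp a | c ≟ opp b
  ... | yes refl | _        = b-out (subst D (·-cancel z a b) zabc∈D)
  ... | no _     | yes refl = a-out (subst D (·-opp (z · a) b) zabc∈D)
  ... | no c≢ā   | no c≢b̄   =
    out-out zc∈D (flip-out z∈D zc∈D a-out (c≢ā ∘ ≡opp-sym))
                 (flip-out z∈D zc∈D b-out (c≢b̄ ∘ ≡opp-sym))
            (subst D (·-rotate z a b c) zabc∈D)

  double-out : ∀ {z a b} → D z → Out z a → b ≢ opp a → D (z · a · b · b) → Out z b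
  double-out {z} {a} {b} z∈D a-out b≢ā zabb∈D zb∈D =
    out-out zb∈D (flip-out z∈D zb∈D a-out (b≢ā ∘ ≡opp-sym)) (flip-out-self z∈D zb∈D)
            (subst D (cong (_· b) (·-comm z a b)) zabb∈D)

  -- By `out-out` the point `z · a · b` is outside `D`, so the neighbour of `z · a · b · c` in `D`
  -- along the axis of `c` lies on the far side.
  prolong : ∀ {z a b c} → D z → Out z a → Out z b → D (z · a · b · c) → D (z · a · b · c · c)
  prolong {z} {a} {b} {c} z∈D a-out b-out zabc∈D with cube-neighbour zabc∈D c
  ... | inj₁ p = p
  ... | inj₂ p = contradiction (subst D (·-opp (z · a · b) c) p) (out-out z∈D a-out b-out)

  -- Being outside `D`, the point `z · a · a` has a single dominator. An outward `a` is therefore a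
  -- source of at most one `b`, which the final pigeonhole argument rests on.
  target-unique : ∀ {z a b c} → D z → Out z a → D (z · a · a · b) → D (z · a · a · c) → b ≡ c
  target-unique z∈D a-out = dominator-unique (out-out z∈D a-out a-out)

  -- The dominator zakc of zak also dominates zaak, as zaabk would; so c = b, and zab then has the two
  -- dominators zabk and zaba.
  flat : ∀ {z a b k} → D z → Out z a → Out z b → Out z k → k ≢ a → k ≢ b →
         D (z · a · a · b) → ¬ D (z · a · a · b · k)
  flat {z} {a} {b} {k} z∈D a-out b-out k-out k≢a k≢b zaab∈D zaabk∈D
    with dominated (out-out z∈D a-out k-out)
  ... | c , zakc∈D = k≢a (dominator-unique (out-out z∈D a-out b-out) zabk∈D zaba∈D)
    where
    c-out : Out z c
    c-out = dominator-out z∈D a-out k-out zakc∈D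
    zaakc∈D : D (z · a · a · k · c)
    zaakc∈D = subst D (trans (cong (_· a) (·-rotate z k c a)) (·-rotate (z · a) k c a))
      (prolong z∈D k-out c-out (subst D (sym (·-rotate z k c a)) zakc∈D))
    c≡b : c ≡ b
    c≡b = dominator-unique (k≢b ∘ λ zaak∈D → target-unique z∈D a-out zaak∈D zaab∈D)
      zaakc∈D (subst D (·-comm (z · a · a) b k) zaabk∈D)
    zabk∈D : D (z · a · b · k)
    zabk∈D = subst D (·-comm (z · a) k b) (subst (λ x → D (z · a · k · x)) c≡b zakc∈D)
    zaba∈D : D (z · a · b · a)
    zaba∈D = subst D (·-comm (z · a) a b) zaab∈D

  -- Read from the adjacent corner `z · opp k`, the conclusion says that `a` is a source of `b`
  -- there too: the relation is carried across the edge.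
  flat-opp : ∀ {z a b k} → D z → Out z a → Out z b → Out z k → k ≢ a → k ≢ b →
             D (z · a · a · b) → D (z · a · a · b · opp k)
  flat-opp {k = k} z∈D a-out b-out k-out k≢a k≢b zaab∈D =
    inner zaab∈D (flat z∈D a-out b-out k-out k≢a k≢b zaab∈D)

  -- If `z · a · a · a` is in `D`, then `flat` leaves only `b = a`. Otherwise the dominating
  -- direction `c` of `z · a · a` is outward, and prolonging along `a` shows that `c` also dominates
  -- `z · a · a · a`, whence `c = b`.
  shorten : ∀ {z a b} → D z → Out z a → Out z b → D (z · a · a · a · b) → D (z · a · a · b)
  shorten {z} {a} {b} z∈D a-out b-out zaaab∈D
    with dominated (out-out z∈D a-out a-out) | D? (z · a · a · a) | b ≟ a
  ... | _           | yes zaaa∈D | yes refl = zaaa∈D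
  ... | _           | yes zaaa∈D | no b≢a   =
    contradiction zaaab∈D (flat z∈D a-out a-out b-out b≢a b≢a zaaa∈D)
  ... | c , zaac∈D  | no zaaa∉D  | _        =
    subst (λ x → D (z · a · a · x)) (dominator-unique zaaa∉D zaaac∈D zaaab∈D) zaac∈D
    where
    c-out : Out z c
    c-out = dominator-out z∈D a-out a-out zaac∈D
    zaaac∈D : D (z · a · a · a · c)
    zaaac∈D = subst D (trans (cong (λ w → w · a · a) (·-comm z c a)) (sym (·-rotate (z · a) a a c)))
      (prolong z∈D c-out a-out (subst D (·-rotate z a a c) zaac∈D))

-- Counting double and triple steps into D modulo 2 and 3.

module Counting {n : ℕ} (q : ℕ) (n≡4+6q : n ≡ 4 + q * 6) (𝒟 : CubeDomination n) where
  open CubeDomination 𝒟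
  open Shifts _·_ ·-comm

  private
    -- This is `n - 1`, a multiple of 3.
    m = 3 + q * 6
    ds = directions n
    N = neighbourSum ds

  indicator : Pt → ℕ
  indicator w with D? w
  ... | yes _ = 1
  ... | no  _ = 0

  indicator-yes : ∀ {w} → D w → indicator w ≡ 1
  indicator-yes {w} w∈D with D? w
  ... | yes _   = refl
  ... | no  w∉D = contradiction w∈D w∉D

  indicator-no : ∀ {w} → ¬ D w → indicator w ≡ 0
  indicator-no {w} w∉D with D? w
  ... | yes w∈D = contradiction w∈D w∉D
  ... | no  _   = refl

  -- Outside `D` only the dominator counts; inside `D` each of the `n = 1 + m` axes contributes one
  -- neighbour.
  N-indicator : ∀ w → N indicator w ≡ 1 + m * indicator w
  N-indicator w with D? w
  ... | no w∉D with dominated w∉D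
  ...   | a , wa∈D = trans
    (sum-single (indicator ∘ (w ·_)) (directions-unique n) (∈-directions a)
      (λ _ b≢a → indicator-no (b≢a ∘ λ wb∈D → dominator-unique w∉D wb∈D wa∈D)))
    (trans (indicator-yes wa∈D) (cong suc (sym (*-zeroʳ m))))
  N-indicator w | yes w∈D = trans
    (sum-signs (indicator ∘ (w ·_)) one (allFin n))
    (trans (length-tabulate {n = n} (λ i → i)) (trans n≡4+6q (cong suc (sym (*-identityʳ m)))))
    where
    one : ∀ i → indicator (w · (i , Sign.+)) + indicator (w · (i , Sign.-)) ≡ 1
    one i with cube-neighbour w∈D (i , Sign.+)
    ... | inj₁ p = cong₂ _+_ (indicator-yes p) (indicator-no (cube-neighbour-unique w∈D p))
    ... | inj₂ p = cong₂ _+_ (indicator-no (cube-neighbour-unique w∈D p)) (indicator-yes p)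

  N²-indicator : ∀ w → N (N indicator) w ≡ n * 2 * 1 + m * N indicator w
  N²-indicator w = begin
    N (N indicator) w                      ≡⟨ neighbourSum-cong ds N-indicator w ⟩
    N (λ u → 1 + m * indicator u) w        ≡⟨ neighbourSum-affine ds 1 m indicator w ⟩
    length ds * 1 + m * N indicator w      ≡⟨ cong (λ l → l * 1 + m * N indicator w) (length-directions n) ⟩
    n * 2 * 1 + m * N indicator w          ∎
    where open ≡-Reasoning

  N³-indicator : ∀ w → N (N (N indicator)) w ≡ n * 2 * (n * 2 * 1) + m * N (N indicator) w
  N³-indicator w = begin
    N (N (N indicator)) w
      ≡⟨ neighbourSum-cong ds N²-indicator w ⟩
    N (λ u → n * 2 * 1 + m * N indicator u) w
      ≡⟨ neighbourSum-affine ds (n * 2 * 1) m (N indicator) w ⟩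
    length ds * (n * 2 * 1) + m * N (N indicator) w
      ≡⟨ cong (λ l → l * (n * 2 * 1) + m * N (N indicator) w) (length-directions n) ⟩
    n * 2 * (n * 2 * 1) + m * N (N indicator) w ∎
    where open ≡-Reasoning

  -- Outside `D` the second iterate of `N` on the indicator is odd, so by `frobenius₂` the number of
  -- double steps into `D` is odd and cannot be two.
  third-double-step : ∀ {w a b} → ¬ D w → D (w · a · a) → D (w · b · b) → a ≢ b →
                      ∃[ c ] (c ≢ a × c ≢ b × D (w · c · c))
  third-double-step {w} {a} {b} w∉D waa∈D wbb∈D a≢b
    with Any.any? (λ c → ¬? (c ≟ a) ×-dec ¬? (c ≟ b) ×-dec D? (w · c · c)) ds
  ... | yes ∃c = Any.satisfied ∃c
  ... | no ∄c with frobenius₂ ds indicator w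
  ...   | r , N²≡ = contradiction parity λ ()
    where
    open ≡-Reasoning
    S₂≡2 : sum (map (λ c → indicator (w · c · c)) ds) ≡ 2
    S₂≡2 = trans
      (sum-pair (λ c → indicator (w · c · c)) (directions-unique n) (∈-directions a) (∈-directions b) a≢b
        (λ c∈ c≢a c≢b → indicator-no (λ wcc∈D → ∄c (lose c∈ (c≢a , c≢b , wcc∈D)))))
      (cong₂ _+_ (indicator-yes waa∈D) (indicator-yes wbb∈D))
    -- At `w` the second iterate is `2n + (n - 1) = 11 + 18q`.
    eq : ∀ q → (4 + q * 6) * 2 * 1 + (3 + q * 6) * (1 + (3 + q * 6) * 0) ≡ 1 + (5 + 9 * q) * 2
    eq = solve-∀
    N²-value : 1 + (5 + 9 * q) * 2 ≡ 2 + r * 2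
    N²-value = begin
      1 + (5 + 9 * q) * 2                  ≡⟨ eq q ⟨
      (4 + q * 6) * 2 * 1 + m * (1 + m * 0) ≡⟨ cong (λ x → x * 2 * 1 + m * (1 + m * 0)) n≡4+6q ⟨
      n * 2 * 1 + m * (1 + m * 0)          ≡⟨ cong (λ x → n * 2 * 1 + m * (1 + m * x)) (indicator-no w∉D) ⟨
      n * 2 * 1 + m * (1 + m * indicator w) ≡⟨ cong (λ x → n * 2 * 1 + m * x) (N-indicator w) ⟨
      n * 2 * 1 + m * N indicator w        ≡⟨ N²-indicator w ⟨
      N (N indicator) w                    ≡⟨ N²≡ ⟩
      sum (map (λ c → indicator (w · c · c)) ds) + r * 2 ≡⟨ cong (_+ r * 2) S₂≡2 ⟩
      2 + r * 2                            ∎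
    parity : 1 ≡ 0
    parity = begin
      1                            ≡⟨ [m+kn]%n≡m%n 1 (5 + 9 * q) 2 ⟨
      (1 + (5 + 9 * q) * 2) % 2    ≡⟨ cong (_% 2) N²-value ⟩
      (2 + r * 2) % 2              ≡⟨ [m+kn]%n≡m%n 2 r 2 ⟩
      0                            ∎

  -- The third iterate is 1 modulo 3, while by `frobenius₃` it would be 0 if no triple step reached
  -- `D`.
  triple-step : ∀ w → ∃[ a ] D (w · a · a · a)
  triple-step w with Any.any? (λ a → D? (w · a · a · a)) ds
  ... | yes ∃a = Any.satisfied ∃a
  ... | no ∄a with frobenius₃ ds indicator w
  ...   | r , N³≡ = contradiction residue λ ()
    where
    open ≡-Reasoning
    X = N (N indicator) w
    -- Chosen so that `1 + 3k = (2n)² + (n - 1)X`. Any value of `X` is admissible because 3 divides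
    -- `n - 1`.
    k = 21 + 64 * q + 48 * q * q + (1 + 2 * q) * X
    eq : ∀ q X → (4 + q * 6) * 2 * ((4 + q * 6) * 2 * 1) + (3 + q * 6) * X ≡
                 1 + (21 + 64 * q + 48 * q * q + (1 + 2 * q) * X) * 3
    eq = solve-∀
    N³-value : 1 + k * 3 ≡ 0 + r * 3
    N³-value = begin
      1 + k * 3                            ≡⟨ eq q X ⟨
      (4 + q * 6) * 2 * ((4 + q * 6) * 2 * 1) + m * X ≡⟨ cong (λ x → x * 2 * (x * 2 * 1) + m * X) n≡4+6q ⟨
      n * 2 * (n * 2 * 1) + m * X          ≡⟨ N³-indicator w ⟨
      N (N (N indicator)) w                ≡⟨ N³≡ ⟩
      sum (map (λ a → indicator (w · a · a · a)) ds) + r * 3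
        ≡⟨ cong (_+ r * 3) (sum-zero (λ a → indicator (w · a · a · a)) {ds}
             (λ a∈ → indicator-no (∄a ∘ lose a∈))) ⟩
      0 + r * 3                            ∎
    residue : 1 ≡ 0
    residue = begin
      1                    ≡⟨ [m+kn]%n≡m%n 1 k 3 ⟨
      (1 + k * 3) % 3      ≡⟨ cong (_% 3) N³-value ⟩
      (0 + r * 3) % 3      ≡⟨ [m+kn]%n≡m%n 0 r 3 ⟩
      0                    ∎

  -- Sources of an outward direction and the pigeonhole argument.

  open Corners 𝒟

  -- From `z · i`, which is outside `D`, two double steps into `D` are known: along `j`, and along
  -- `opp i`, which ends at `z · opp i`. The third one forced by parity gives the new source.
  another-source : ∀ {z i j} → D z → Out z i → Out z j → D (z · j · j · i) →
                   ∃[ k ] (k ≢ j × Out z k × D (z · k · k · i))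
  another-source {z} {i} {j} z∈D i-out j-out zjji∈D
    with third-double-step i-out (subst D (·-rotate z j j i) zjji∈D)
           (subst D (cong (_· opp i) (sym (·-opp z i))) (inner z∈D i-out))
           (λ where refl → j-out (inner z∈D i-out))
  ... | k , k≢j , k≢ī , zikk∈D =
    k , k≢j , double-out z∈D i-out k≢ī zikk∈D , subst D (sym (·-rotate z k k i)) zikk∈D

  source : ∀ {z i} → D z → Out z i → ∃[ j ] (Out z j × D (z · j · j · i))
  source {z} {i} z∈D i-out with triple-step (z · i)
  ... | d , ziddd∈D with D? (z · d) | d ≟ opp i
  ...   | no d-out | _ = d , d-out , shorten z∈D d-out i-out zdddi∈D
    where
    zdddi∈D : D (z · d · d · d · i)
    zdddi∈D = subst D (trans (cong (_· d) (sym (·-rotate z d d i))) (·-comm (z · d · d) i d)) ziddd∈D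
  -- Here the triple step ends at `z · d · d`, one step beyond the corner `z · d` in an outward
  -- direction.
  ...   | yes zd∈D | yes refl =
    contradiction (subst D (cong (λ w → w · d · d) (·-opp z i)) ziddd∈D) (flip-out-self z∈D zd∈D)
  -- At the corner `z · d` the direction `d` is outward and is a source of `i`. Parity gives a
  -- second source `k` there, and `flat-opp` carries it back to `z`.
  ...   | yes zd∈D | no d≢ī
    with another-source zd∈D (flip-out z∈D zd∈D i-out (d≢ī ∘ ≡opp-sym)) (flip-out-self z∈D zd∈D)
           (subst D (trans (cong (_· d) (sym (·-rotate z d d i))) (·-comm (z · d · d) i d)) ziddd∈D)
  ...     | k , k≢d , k-out , zdkki∈D =
    k
    , subst (λ w → Out w k) (·-opp z d)
        (flip-out zd∈D (subst D (sym (·-opp z d)) z∈D) k-out (λ k≡d̿ → k≢d (trans k≡d̿ (opp-involutive d))))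
    , subst D (trans (cong (_· opp d) (trans (cong (_· i) (sym (·-rotate z k k d))) (·-comm (z · k · k) d i)))
                     (·-opp (z · k · k · i) d))
        (flat-opp zd∈D k-out (flip-out z∈D zd∈D i-out (d≢ī ∘ ≡opp-sym)) (flip-out-self z∈D zd∈D)
           (k≢d ∘ sym) (λ where refl → i-out zd∈D) zdkki∈D)

  -- Each of the n outward directions i has two sources j, while each j is the source of only one i.
  D-empty : ∀ {z} → ¬ D z
  D-empty {z} z∈D = collision (Fin.pigeonhole (n<1+n n) axis)
    where
    i₀ : Fin n
    i₀ = subst Fin (sym n≡4+6q) zero

    out : Fin n → Direction n
    out i = proj₁ (out-on-axis z∈D i)

    out-axis : ∀ i → proj₁ (out i) ≡ i
    out-axis i = proj₁ (proj₂ (out-on-axis z∈D i))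

    Source : Fin n → Direction n → Set
    Source i j = Out z j × D (z · j · j · out i)

    src : ∀ i → ∃[ j ] Source i j
    src i = source z∈D (proj₂ (proj₂ (out-on-axis z∈D i)))

    src′ : ∃[ j ] (j ≢ proj₁ (src i₀) × Source i₀ j)
    src′ with src i₀
    ... | j , j-out , p = another-source z∈D (proj₂ (proj₂ (out-on-axis z∈D i₀))) j-out p

    -- An axis determines its outward direction, and a source determines its target.
    source-axis-injective : ∀ {i i′ j j′} → Source i j → Source i′ j′ → proj₁ j ≡ proj₁ j′ → j ≡ j′ × i ≡ i′
    source-axis-injective {i} {i′} (j-out , p) (j′-out , p′) eq with out-axis-injective z∈D j-out j′-out eq
    ... | refl = refl ,
      trans (sym (out-axis i)) (trans (cong proj₁ (target-unique z∈D j-out p p′)) (out-axis i′))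

    -- One source for each of the `n` targets and a second one for `i₀` make `n + 1` sources on `n`
    -- axes.
    axis : Fin (suc n) → Fin n
    axis zero    = proj₁ (proj₁ src′)
    axis (suc i) = proj₁ (proj₁ (src i))

    collision : ¬ (∃[ a ] ∃[ b ] (a Fin.< b × axis a ≡ axis b))
    collision (zero , suc i , _ , eq)
      with source-axis-injective (proj₂ (proj₂ src′)) (proj₂ (src i)) eq
    ... | src′≡src , refl = proj₁ (proj₂ src′) src′≡src
    collision (suc i , suc j , i<j , eq)
      with source-axis-injective (proj₂ (src i)) (proj₂ (src j)) eq
    ... | _ , refl = <-irrefl refl i<j

-- Unit shifts of integer points and the cube with coordinates -1 and 0.

infixl 6 _⊕_
_⊕_ : ∀ {n} → Point n → Direction n → Point n
U ⊕ (i , s) = U [ i ]%= (_+ℤ (s ◃ 1))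

+-swap : ∀ x a b → x +ℤ a +ℤ b ≡ x +ℤ b +ℤ a
+-swap x a b = trans (ℤ.+-assoc x a b) (trans (cong (x +ℤ_) (ℤ.+-comm a b)) (sym (ℤ.+-assoc x b a)))

+-opposite : ∀ x s → x +ℤ (s ◃ 1) +ℤ (opposite s ◃ 1) ≡ x
+-opposite x Sign.+ = trans (ℤ.+-assoc x 1ℤ -1ℤ) (ℤ.+-identityʳ x)
+-opposite x Sign.- = trans (ℤ.+-assoc x -1ℤ 1ℤ) (ℤ.+-identityʳ x)

⊕-comm : ∀ {n} (U : Point n) a b → U ⊕ a ⊕ b ≡ U ⊕ b ⊕ a
⊕-comm (u ∷ U) (zero  , s) (zero  , t) = cong (_∷ U) (+-swap u (s ◃ 1) (t ◃ 1))
⊕-comm (u ∷ U) (zero  , s) (suc j , t) = refl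
⊕-comm (u ∷ U) (suc i , s) (zero  , t) = refl
⊕-comm (u ∷ U) (suc i , s) (suc j , t) = cong (u ∷_) (⊕-comm U (i , s) (j , t))

⊕-opp : ∀ {n} (U : Point n) a → U ⊕ a ⊕ opp a ≡ U
⊕-opp (u ∷ U) (zero  , s) = cong (_∷ U) (+-opposite u s)
⊕-opp (u ∷ U) (suc i , s) = cong (u ∷_) (⊕-opp U (i , s))

_⊖_ : ∀ {n} → Point n → Point n → Point n
_⊖_ = zipWith _-ℤ_

⊕-⊖ : ∀ {n} (Z X : Point n) a → (Z ⊕ a) ⊖ X ≡ (Z ⊖ X) ⊕ a
⊕-⊖ (z ∷ Z) (x ∷ X) (zero  , s) = cong (_∷ (Z ⊖ X)) (+-swap z (s ◃ 1) (ℤ.- x))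
⊕-⊖ (z ∷ Z) (x ∷ X) (suc i , s) = cong (z -ℤ x ∷_) (⊕-⊖ Z X (i , s))

MinusOneOrZero : ℤ → Set
MinusOneOrZero x = x ≡ -1ℤ ⊎ x ≡ 0ℤ

inMinusOneZero? : ∀ {n} (U : Point n) → Dec (InMinusOneZero U)
inMinusOneZero? = all? λ x → (x ℤ.≟ -1ℤ) ⊎-dec (x ℤ.≟ 0ℤ)

coordinate-shift : ∀ {x} → MinusOneOrZero x → ∀ s →
                   MinusOneOrZero (x +ℤ (s ◃ 1)) ⊎ MinusOneOrZero (x +ℤ (opposite s ◃ 1))
coordinate-shift (inj₁ refl) Sign.+ = inj₁ (inj₂ refl)
coordinate-shift (inj₁ refl) Sign.- = inj₂ (inj₂ refl)
coordinate-shift (inj₂ refl) Sign.+ = inj₂ (inj₁ refl)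
coordinate-shift (inj₂ refl) Sign.- = inj₁ (inj₁ refl)

-- The two shifted values differ by 2, but -1 and 0 only by 1.
coordinate-shifts-disjoint : ∀ x s → MinusOneOrZero (x +ℤ (s ◃ 1)) →
                             ¬ MinusOneOrZero (x +ℤ (opposite s ◃ 1))
coordinate-shifts-disjoint x s p q = disjoint s p (subst MinusOneOrZero eq q)
  where
  t = opposite s ◃ 1
  eq : x +ℤ t ≡ x +ℤ (s ◃ 1) +ℤ t +ℤ t
  eq = cong (_+ℤ t) (sym (+-opposite x s))
  disjoint : ∀ s {y} → MinusOneOrZero y → ¬ MinusOneOrZero (y +ℤ (opposite s ◃ 1) +ℤ (opposite s ◃ 1))
  disjoint Sign.+ (inj₁ refl) (inj₁ ())
  disjoint Sign.+ (inj₁ refl) (inj₂ ())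
  disjoint Sign.+ (inj₂ refl) (inj₁ ())
  disjoint Sign.+ (inj₂ refl) (inj₂ ())
  disjoint Sign.- (inj₁ refl) (inj₁ ())
  disjoint Sign.- (inj₁ refl) (inj₂ ())
  disjoint Sign.- (inj₂ refl) (inj₁ ())
  disjoint Sign.- (inj₂ refl) (inj₂ ())

cube-shift : ∀ {n} {U : Point n} → InMinusOneZero U → ∀ a →
             InMinusOneZero (U ⊕ a) ⊎ InMinusOneZero (U ⊕ opp a)
cube-shift (u ∷ us) (zero , s) = Sum.map (_∷ us) (_∷ us) (coordinate-shift u s)
cube-shift (u ∷ us) (suc i , s) = Sum.map (u ∷_) (u ∷_) (cube-shift us (i , s))

cube-shifts-disjoint : ∀ {n} (U : Point n) a → InMinusOneZero (U ⊕ a) → ¬ InMinusOneZero (U ⊕ opp a)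
cube-shifts-disjoint (x ∷ U) (zero  , s) (u ∷ _)  (u′ ∷ _)  = coordinate-shifts-disjoint x s u u′
cube-shifts-disjoint (_ ∷ U) (suc i , s) (_ ∷ us) (_ ∷ us′) = cube-shifts-disjoint U (i , s) us us′

-- Shifts along different axes each leave the other's coordinate untouched, so together they would
-- show every coordinate of `U` to be -1 or 0. On a common axis, opposite shifts are excluded by
-- `cube-shifts-disjoint`.
cube-shift-unique : ∀ {n} (U : Point n) a b → ¬ InMinusOneZero U →
                    InMinusOneZero (U ⊕ a) → InMinusOneZero (U ⊕ b) → a ≡ b
cube-shift-unique (_ ∷ U) (suc i , s) (zero , t) U∉ (u ∷ _) (_ ∷ us) = contradiction (u ∷ us) U∉
cube-shift-unique (_ ∷ U) (zero , s) (suc j , t) U∉ (_ ∷ us) (u ∷ _) = contradiction (u ∷ us) U∉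
cube-shift-unique (_ ∷ U) (suc i , s) (suc j , t) U∉ (u ∷ us) (_ ∷ us′) =
  cong (λ (k , r) → suc k , r) (cube-shift-unique U (i , s) (j , t) (U∉ ∘ (u ∷_)) us us′)
cube-shift-unique U@(_ ∷ _) a@(zero , s) b@(zero , t) U∉ p q with same-axis a b refl
... | inj₁ refl = refl
... | inj₂ refl = contradiction q (cube-shifts-disjoint U a p)

-- The set Υₙ as the cube together with the points one unit step away.

dist₁-refl : ∀ {n} (U : Point n) → dist₁ U U ≡ 0
dist₁-refl []      = refl
dist₁-refl (u ∷ U) = cong₂ _+_ (cong ∣_∣ (ℤ.+-inverseʳ u)) (dist₁-refl U)

dist₁-zero : ∀ {n} (X U : Point n) → dist₁ X U ≡ 0 → X ≡ U
dist₁-zero []      []      _  = refl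
dist₁-zero (x ∷ X) (u ∷ U) eq =
  cong₂ _∷_ (ℤ.i-j≡0⇒i≡j x u (ℤ.∣i∣≡0⇒i≡0 (m+n≡0⇒m≡0 _ eq))) (dist₁-zero X U (m+n≡0⇒n≡0 ∣ x -ℤ u ∣ eq))

dist₁-shift : ∀ {n} (U : Point n) a → dist₁ (U ⊕ a) U ≡ 1
dist₁-shift (u ∷ U) (zero  , s) = cong₂ _+_ (trans (cong ∣_∣ eq) (abs s)) (dist₁-refl U)
  where
  eq : u +ℤ (s ◃ 1) -ℤ u ≡ s ◃ 1
  eq = trans (+-swap u (s ◃ 1) (ℤ.- u))
             (trans (cong (_+ℤ (s ◃ 1)) (ℤ.+-inverseʳ u)) (ℤ.+-identityˡ (s ◃ 1)))
  abs : ∀ s → ∣ s ◃ 1 ∣ ≡ 1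
  abs Sign.+ = refl
  abs Sign.- = refl
dist₁-shift (u ∷ U) (suc i , s) = cong₂ _+_ (cong ∣_∣ (ℤ.+-inverseʳ u)) (dist₁-shift U (i , s))

∣i∣≡1⇒sign : ∀ i → ∣ i ∣ ≡ 1 → ∃[ s ] i ≡ s ◃ 1
∣i∣≡1⇒sign (ℤ.+ 1)    refl = Sign.+ , refl
∣i∣≡1⇒sign ℤ.-[1+ 0 ] refl = Sign.- , refl

-- The first coordinate in which the points differ uses up the whole distance: the difference there
-- is a unit, and all later coordinates agree.
dist₁≤1 : ∀ {n} (X U : Point n) → dist₁ X U ≤ 1 → X ≡ U ⊎ ∃[ a ] X ≡ U ⊕ a
dist₁≤1 []      []      _ = inj₁ refl
dist₁≤1 (x ∷ X) (u ∷ U) d≤1 with ∣ x -ℤ u ∣ in eq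
... | zero with ℤ.i-j≡0⇒i≡j x u (ℤ.∣i∣≡0⇒i≡0 eq)
...   | refl = Sum.map (cong (u ∷_)) (λ ((i , s) , X≡) → (suc i , s) , cong (u ∷_) X≡) (dist₁≤1 X U d≤1)
dist₁≤1 (x ∷ X) (u ∷ U) (s≤s d≤0) | suc k
  with ∣i∣≡1⇒sign (x -ℤ u) (trans eq (cong suc (m+n≡0⇒m≡0 k (n≤0⇒n≡0 d≤0))))
... | s , x-u≡s = inj₂ ((zero , s) ,
  cong₂ _∷_ (trans (sym (+-minus u x)) (cong (u +ℤ_) x-u≡s))
            (dist₁-zero X U (m+n≡0⇒n≡0 k (n≤0⇒n≡0 d≤0))))
  where
  +-minus : ∀ u x → u +ℤ (x -ℤ u) ≡ x
  +-minus u x = trans (ℤ.+-comm u (x -ℤ u)) (trans (ℤ.+-assoc x (ℤ.- u) u)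
    (trans (cong (x +ℤ_) (ℤ.+-inverseˡ u)) (ℤ.+-identityʳ x)))

Upsilon⇒cube : ∀ {n} {U : Point n} → Upsilon n U → InMinusOneZero U ⊎ ∃[ a ] InMinusOneZero (U ⊕ a)
Upsilon⇒cube {U = U} (X , X∈ , d≤1) with dist₁≤1 X U d≤1
... | inj₁ refl       = inj₁ X∈
... | inj₂ (a , refl) = inj₂ (a , X∈)

cube⇒Upsilon : ∀ {n} {U : Point n} → InMinusOneZero U → Upsilon n U
cube⇒Upsilon {U = U} U∈ = U , U∈ , ≤-trans (≤-reflexive (dist₁-refl U)) z≤n

shifted-cube⇒Upsilon : ∀ {n} {U : Point n} a → InMinusOneZero (U ⊕ a) → Upsilon n U
shifted-cube⇒Upsilon {U = U} a Ua∈ = U ⊕ a , Ua∈ , ≤-reflexive (dist₁-shift U a)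

-- From an integer tiling to a cube domination.

module _ {n : ℕ} {T : Point n → Set} (tiling : IsIntegerTiling n T) where

  private
    cover = proj₁ tiling
    unique = proj₂ tiling

  InCube : Point n → Set
  InCube Z = ∃[ X ] (T X × InMinusOneZero (Z ⊖ X))

  -- Although `T` is an arbitrary predicate, the covering supplies one candidate cube, and
  -- uniqueness of the tile containing `Z` rules out all others.
  inCube? : ∀ Z → Dec (InCube Z)
  inCube? Z with cover Z
  ... | X , X∈T , Z∈ΥX with inMinusOneZero? (Z ⊖ X)
  ...   | yes Z∈X = yes (X , X∈T , Z∈X)
  ...   | no  Z∉X = no λ (Y , Y∈T , Z∈Y) →
    Z∉X (subst (InMinusOneZero ∘ (Z ⊖_)) (unique Z Y X Y∈T X∈T (cube⇒Upsilon Z∈Y) Z∈ΥX) Z∈Y)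

  shifted-cube-covers : ∀ {Z X} a → InMinusOneZero ((Z ⊕ a) ⊖ X) → InTranslate n X Z
  shifted-cube-covers {Z} {X} a = shifted-cube⇒Upsilon a ∘ subst InMinusOneZero (⊕-⊖ Z X a)

  cubeDomination : CubeDomination n
  cubeDomination = record
    { Pt = Point n
    ; _·_ = _⊕_
    ; ·-comm = ⊕-comm
    ; ·-opp = ⊕-opp
    ; D = InCube
    ; D? = inCube?
    ; dominated = dominated
    -- Both tiles contain `Z`, hence coincide, and the claim reduces to a single cube.
    ; dominator-unique = λ
        {Z} {a} {b} Z∉D (X , X∈T , Za∈X) (Y , Y∈T , Zb∈Y) →
          dominator-unique Z∉D a b X∈T Za∈X Zb∈Y
            (unique Z X Y X∈T Y∈T (shifted-cube-covers a Za∈X) (shifted-cube-covers b Zb∈Y))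
    ; cube-neighbour = λ {Z} (X , X∈T , Z∈X) a →
        Sum.map (λ p → X , X∈T , subst InMinusOneZero (sym (⊕-⊖ Z X a)) p)
                (λ p → X , X∈T , subst InMinusOneZero (sym (⊕-⊖ Z X (opp a))) p)
                (cube-shift Z∈X a)
    ; cube-neighbour-unique = λ
        {Z} {a} _ (X , X∈T , Za∈X) (Y , Y∈T , Zā∈Y) →
          disjoint a Za∈X Zā∈Y
            (unique Z X Y X∈T Y∈T (shifted-cube-covers a Za∈X) (shifted-cube-covers (opp a) Zā∈Y))
    }
    where
    dominated : ∀ {Z} → ¬ InCube Z → ∃[ a ] InCube (Z ⊕ a)
    dominated {Z} Z∉D with cover Z
    ... | X , X∈T , Z∈ΥX with Upsilon⇒cube Z∈ΥX
    ...   | inj₁ Z∈X        = contradiction (X , X∈T , Z∈X) Z∉D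
    ...   | inj₂ (a , Za∈X) = a , X , X∈T , subst InMinusOneZero (sym (⊕-⊖ Z X a)) Za∈X

    dominator-unique : ∀ {Z X Y} → ¬ InCube Z → ∀ a b → T X → InMinusOneZero ((Z ⊕ a) ⊖ X) →
                       InMinusOneZero ((Z ⊕ b) ⊖ Y) → X ≡ Y → a ≡ b
    dominator-unique {Z} {X} Z∉D a b X∈T Za∈X Zb∈X refl =
      cube-shift-unique (Z ⊖ X) a b (λ Z∈X → Z∉D (X , X∈T , Z∈X))
        (subst InMinusOneZero (⊕-⊖ Z X a) Za∈X) (subst InMinusOneZero (⊕-⊖ Z X b) Zb∈X)

    disjoint : ∀ {Z X Y} a → InMinusOneZero ((Z ⊕ a) ⊖ X) → InMinusOneZero ((Z ⊕ opp a) ⊖ Y) → X ≢ Y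
    disjoint {Z} {X} a Za∈X Zā∈X refl = cube-shifts-disjoint (Z ⊖ X) a
      (subst InMinusOneZero (⊕-⊖ Z X a) Za∈X) (subst InMinusOneZero (⊕-⊖ Z X (opp a)) Zā∈X)

theorem4 : (n : ℕ) (T : Point n → Set) → IsIntegerTiling n T → ¬ (n % 6 ≡ 4)
theorem4 n T tiling n%6≡4 =
  -- A triple step from the origin exhibits a point of `D`, which `D-empty` forbids.
  D-empty (proj₂ (triple-step (replicate n 0ℤ)))
  where
  open Counting (n / 6) (trans (m≡m%n+[m/n]*n n 6) (cong (_+ n / 6 * 6) n%6≡4)) (cubeDomination tiling)
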